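{- Let $p$ be a prime, let $G$ be an extraspecial $p$-group of order $p^{2n+1}$, and let $S\subseteq G\setminus\{1_G\}$ be an inverse-closed set that is closed under conjugation in $G$. Then $X=\mathrm{Cay}(G,S)$ is a Cayley graph of the elementary abelian $p$-group $\mathbb{Z}_p^{2n+1}$.
   Context: A $p$-group $G$ is extraspecial if its centre $Z(G)$ has order $p$ and $Z(G)=G'=\Phi(G)$, where $G'=[G,G]$ is the commutator subgroup and $\Phi(G)$ is the Frattini subgroup; then $|G|=p^{2n+1}$ for some $n\ge1$. $\mathrm{Cay}(G,S)$ is the graph with vertex set $G$ in which $g\sim h$ if and only if $hg^{ -1}\in S$. A graph $X$ is a Cayley graph of a group $K$ if $X\cong\mathrm{Cay}(K,S')$ for some inverse-closed $S'\subseteq K$ not containing the identity. -}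

module Defs where

open import Level using (Level; _⊔_; 0ℓ) renaming (suc to lsuc)
open import Algebra.Bundles using (Group; AbelianGroup)
import Algebra.Construct.Pointwise as Pointwise
import Algebra.Properties.Group as GroupProperties
open import Data.Fin.Base using (Fin)
open import Data.Integer.Base as ℤ using (ℤ; +_; 0ℤ)
import Data.Integer.Properties as ℤ
open import Data.Integer.Divisibility.Signed as ℤ using (_∣_; divides)
open import Data.Integer.Tactic.RingSolver using (solve-∀)
open import Data.Nat.Base using (ℕ; _^_)
open import Data.Product.Base using (Σ; ∃; _,_; proj₁)
open import Data.Sum.Base using (_⊎_)
open import Function.Bundles using (Inverse; _⇔_)
open import Relation.Binary.Bundles using (Setoid)
open import Relation.Binary.Core using (Rel)
open import Relation.Binary.Definitions
  using (Symmetric; Irreflexive; _Respects_; _Respects₂_)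
open import Relation.Binary.PropositionalEquality as ≡ using (_≡_)
import Relation.Binary.Construct.On as On
open import Relation.Unary using (Pred; Decidable; _∈_; _∉_; _⊆_; _≐_)

private
  variable
    a c ℓ r s c₁ c₂ ℓ₁ ℓ₂ r₁ r₂ : Level

HasOrder : Setoid c ℓ → ℕ → Set (c ⊔ ℓ)
HasOrder A n = Inverse A (≡.setoid (Fin n))

module _ (G : Group c ℓ) where
  open Group G

  ⟦_⟧ : Pred Carrier a → Setoid (c ⊔ a) ℓ
  ⟦ A ⟧ = On.setoid {B = Σ Carrier A} setoid proj₁

  record IsSubgroup (H : Pred Carrier a) : Set (c ⊔ ℓ ⊔ a) where
    field
      resp      : H Respects _≈_
      ε-closed  : ε ∈ H
      ∙-closed  : ∀ {x y} → x ∈ H → y ∈ H → x ∙ y ∈ H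
      ⁻¹-closed : ∀ {x} → x ∈ H → x ⁻¹ ∈ H

  data Generated (A : Pred Carrier a) : Pred Carrier (c ⊔ ℓ ⊔ a) where
    gen   : ∀ {x} → x ∈ A → Generated A x
    unit  : Generated A ε
    mul   : ∀ {x y} → Generated A x → Generated A y → Generated A (x ∙ y)
    inv   : ∀ {x} → Generated A x → Generated A (x ⁻¹)
    equal : ∀ {x y} → x ≈ y → Generated A x → Generated A y

  Centre : Pred Carrier (c ⊔ ℓ)
  Centre z = ∀ g → z ∙ g ≈ g ∙ z

  IsCommutator : Pred Carrier (c ⊔ ℓ)
  IsCommutator z = ∃ λ x → ∃ λ y → z ≈ x ⁻¹ ∙ y ⁻¹ ∙ x ∙ y

  CommutatorSubgroup : Pred Carrier (c ⊔ ℓ)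
  CommutatorSubgroup = Generated IsCommutator

  -- The groups of interest are finite, where every subgroup is classically
  -- decidable. Restricting to decidable subgroups keeps maximality
  -- constructively meaningful: for an arbitrary predicate H between M and G
  -- one could not decide which of the two it equals.
  record IsMaximalSubgroup (M : Pred Carrier ℓ) : Set (c ⊔ lsuc ℓ) where
    field
      isSubgroup : IsSubgroup M
      decidable  : Decidable M
      proper     : ∃ λ x → x ∉ M
      maximal    : (H : Pred Carrier ℓ) → IsSubgroup H → Decidable H →
                   M ⊆ H → H ⊆ M ⊎ (∀ x → x ∈ H)

  FrattiniSubgroup : Pred Carrier (c ⊔ lsuc ℓ)
  FrattiniSubgroup x = (M : Pred Carrier ℓ) → IsMaximalSubgroup M → x ∈ M

  IsPGroup : ℕ → Set (c ⊔ ℓ)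
  IsPGroup p = ∃ λ k → HasOrder setoid (p ^ k)

  record IsExtraspecial (p : ℕ) : Set (c ⊔ lsuc ℓ) where
    field
      isPGroup            : IsPGroup p
      centreOrder         : HasOrder ⟦ Centre ⟧ p
      centre≐commutator   : Centre ≐ CommutatorSubgroup
      commutator≐frattini : CommutatorSubgroup ≐ FrattiniSubgroup

record Graph (c ℓ r : Level) : Set (lsuc (c ⊔ ℓ ⊔ r)) where
  field
    vertices : Setoid c ℓ
  open Setoid vertices public using (_≈_) renaming (Carrier to Vertex)
  field
    Adj    : Rel Vertex r
    resp   : Adj Respects₂ _≈_
    sym    : Symmetric Adj
    irrefl : Irreflexive _≈_ Adj

record _≅_ (X : Graph c₁ ℓ₁ r₁) (Y : Graph c₂ ℓ₂ r₂)
       : Set (c₁ ⊔ ℓ₁ ⊔ r₁ ⊔ c₂ ⊔ ℓ₂ ⊔ r₂) where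
  private
    module X = Graph X
    module Y = Graph Y
  field
    bijection : Inverse X.vertices Y.vertices
  open Inverse bijection public using (to; from)
  field
    adjacency : ∀ g h → X.Adj g h ⇔ Y.Adj (to g) (to h)

-- Inverse-closed subsets not containing the identity. Membership need not be
-- decidable.
record ConnectionSet (G : Group c ℓ) (s : Level) : Set (c ⊔ ℓ ⊔ lsuc s) where
  open Group G
  field
    set           : Pred Carrier s
    resp          : set Respects _≈_
    ε∉            : ε ∉ set
    inverseClosed : ∀ {x} → x ∈ set → x ⁻¹ ∈ set

ConjugationClosed : (G : Group c ℓ) → ConnectionSet G s → Set (c ⊔ s)
ConjugationClosed G S = ∀ g {x} → x ∈ set → g ∙ x ∙ g ⁻¹ ∈ set
  where open Group G; open ConnectionSet S

Cay : (G : Group c ℓ) → ConnectionSet G s → Graph c ℓ s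
Cay G S = record
  { vertices = setoid
  ; Adj      = λ g h → h ∙ g ⁻¹ ∈ set
  ; resp     = (λ h≈h′ → resp (∙-congʳ h≈h′))
             , (λ g≈g′ → resp (∙-congˡ (⁻¹-cong g≈g′)))
  ; sym      = λ {g} {h} hg⁻¹∈S → resp
      (trans (⁻¹-anti-homo-∙ h (g ⁻¹)) (∙-congʳ (⁻¹-involutive g)))
      (inverseClosed hg⁻¹∈S)
  ; irrefl   = λ {g} g≈h hg⁻¹∈S →
      ε∉ (resp (trans (∙-congʳ (sym g≈h)) (inverseʳ g)) hg⁻¹∈S)
  }
  where
  open Group G
  open GroupProperties G
  open ConnectionSet S

-- If X ≅ Cay K S′ then S′ x is equivalent to adjacency of the vertices
-- corresponding to ε and x, so S′ can be taken at the level of adjacency in X.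
IsCayleyGraphOf : Graph c₁ ℓ₁ r → Group c₂ ℓ₂ →
                  Set (c₁ ⊔ ℓ₁ ⊔ lsuc r ⊔ c₂ ⊔ ℓ₂)
IsCayleyGraphOf {r = r} X K = ∃ λ (S′ : ConnectionSet K r) → X ≅ Cay K S′

module _ (m : ℕ) where

  infix 4 _≡ₘ_

  _≡ₘ_ : Rel ℤ 0ℓ
  i ≡ₘ j = + m ∣ i ℤ.- j

  private
    reflexive : ∀ {i j} → i ≡ j → i ≡ₘ j
    reflexive {i} ≡.refl = divides 0ℤ (ℤ.+-inverseʳ i)

    neg-diff : ∀ i j → ℤ.- (i ℤ.- j) ≡ j ℤ.- i
    neg-diff = solve-∀

    add-diff : ∀ i j k → (i ℤ.- j) ℤ.+ (j ℤ.- k) ≡ i ℤ.- k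
    add-diff = solve-∀

    diff-add : ∀ i j k l →
               (i ℤ.- j) ℤ.+ (k ℤ.- l) ≡ (i ℤ.+ k) ℤ.- (j ℤ.+ l)
    diff-add = solve-∀

    diff-neg : ∀ i j → ℤ.- (i ℤ.- j) ≡ ℤ.- i ℤ.- ℤ.- j
    diff-neg = solve-∀

    m∣-subst : ∀ {i j} → i ≡ j → + m ∣ i → + m ∣ j
    m∣-subst = ≡.subst (+ m ∣_)

  ℤmod : AbelianGroup 0ℓ 0ℓ
  ℤmod = record
    { Carrier = ℤ
    ; _≈_ = _≡ₘ_
    ; _∙_ = ℤ._+_
    ; ε   = 0ℤ
    ; _⁻¹ = ℤ.-_
    ; isAbelianGroup = record
      { isGroup = record
        { isMonoid = record
          { isSemigroup = record
            { isMagma = record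
              { isEquivalence = record
                { refl  = λ {i} → reflexive {i} ≡.refl
                ; sym   = λ {i} {j} p → m∣-subst (neg-diff i j) (ℤ.∣m⇒∣-m p)
                ; trans = λ {i} {j} {k} p q →
                    m∣-subst (add-diff i j k) (ℤ.∣m∣n⇒∣m+n p q)
                }
              ; ∙-cong = λ {i} {j} {k} {l} p q →
                  m∣-subst (diff-add i j k l) (ℤ.∣m∣n⇒∣m+n p q)
              }
            ; assoc = λ i j k → reflexive (ℤ.+-assoc i j k)
            }
          ; identity = (λ i → reflexive (ℤ.+-identityˡ i))
                     , (λ i → reflexive (ℤ.+-identityʳ i))
          }
        ; inverse = (λ i → reflexive (ℤ.+-inverseˡ i))
                  , (λ i → reflexive (ℤ.+-inverseʳ i))
        ; ⁻¹-cong = λ {i} {j} p → m∣-subst (diff-neg i j) (ℤ.∣m⇒∣-m p)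
        }
      ; comm = λ i j → reflexive (ℤ.+-comm i j)
      }
    }

ElementaryAbelian : ℕ → ℕ → Group 0ℓ 0ℓ
ElementaryAbelian p k = Pointwise.group (Fin k) (AbelianGroup.group (ℤmod p))

{-# OPTIONS --safe #-}

-- Write Z for the centre. Commutators lie in Z, which has order p, so G/Z is
-- abelian of exponent p, and a non-central x is conjugate to every element of
-- Zx. Choose a generator g₁ of Z and extend it greedily by g₂, …, gₖ so that
-- v ↦ ∏ gᵢ^(vᵢ mod p) is a bijection T from ℤ_p^k to G. T is additive modulo Z,
-- and translating v along the first generator multiplies T v exactly by a
-- central element. Hence T v (T w)⁻¹ and T (v - w) agree up to Z, and agree
-- exactly when they are central; since S is a union of Z-cosets outside Z,
-- T⁻¹(S) is the required connection set.

module Submission where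

open import Defs
open import Algebra.Bundles using (Group; AbelianGroup; Monoid)
import Algebra.Properties.CommutativeMonoid.Sum as Sum
import Algebra.Properties.CommutativeSemigroup as CommutativeSemigroupProperties
import Algebra.Properties.Group as GroupProperties
import Algebra.Properties.Monoid.Mult as Mult
open import Data.Fin.Base as Fin
  using (Fin; toℕ; fromℕ<; punchOut; finToFun; funToFin)
open import Data.Fin.Permutation using (Permutation′; permutation)
import Data.Fin.Properties as Fin
open import Data.Integer.Base as ℤ using (ℤ; +_; 0ℤ; _%ℕ_; _/ℕ_; ∣_∣)
open import Data.Integer.DivMod using (a≡a%ℕn+[a/ℕn]*n; n%ℕd<d)
open import Data.Integer.Divisibility.Signed using (divides; ∣⇒∣ᵤ)
import Data.Integer.Properties as ℤ
open import Data.Integer.Tactic.RingSolver using (solve-∀)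
open import Data.Nat.Base as ℕ
  using (ℕ; zero; suc; _+_; _*_; _^_; _∸_; _<_; _≤_; _%_; NonZero)
open import Data.Nat.Coprimality using (Coprime; prime⇒coprime; coprime-Bézout)
import Data.Nat.Divisibility as ℕ
open import Data.Nat.DivMod using ([m+kn]%n≡m%n; m<n⇒m%n≡m; m≡m%n+[m/n]*n)
open import Data.Nat.GCD using (module Bézout)
open import Data.Nat.Primality using (Prime; prime⇒nonZero; prime⇒nonTrivial)
import Data.Nat.Properties as ℕ
open import Data.Product.Base using (Σ; ∃; _,_; proj₁; proj₂) renaming (_×_ to _∧_)
open import Data.Sum.Base using (inj₁; inj₂)
open import Data.Vec.Functional using (_∷_)
open import Function.Base using (_∘_; _$_)
open import Function.Bundles using (Inverse; Equivalence; mk⇔; _⇔_)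
open import Function.Definitions using (Injective)
open import Function.Properties.Inverse using (Inverse⇒Injection)
open import Level using (Level; _⊔_)
open import Relation.Binary.Definitions using (Decidable)
open import Relation.Binary.PropositionalEquality as ≡ using (_≡_; _≢_; _≗_)
import Relation.Binary.Reasoning.Setoid as SetoidReasoning
open import Relation.Nullary using (yes; no; ¬_; contradiction)
open import Relation.Nullary.Decidable using (¬?; decidable-stable; map′; via-injection)
open import Relation.Unary as Unary using (Pred; _∈_; _∉_)
open import Tactic.MonoidSolver using (solve)

private
  variable
    a c ℓ s c₁ c₂ ℓ₁ ℓ₂ : Level
    m n p : ℕ

-- Pigeonhole arguments on finite sets.

∃-unhit : m < n → (f : Fin m → Fin n) → ∃ λ y → ∀ i → f i ≢ y
∃-unhit {m} {n} m<n f
  with Fin.any? (λ y → Fin.all? (λ i → ¬? (f i Fin.≟ y)))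
... | yes found = found
... | no  none  = contradiction (Fin.injective⇒≤ section-injective) (ℕ.<⇒≱ m<n)
  where
  -- If every value were hit, choosing preimages would inject `Fin n` into `Fin m`, against `m < n`.
  hit : ∀ y → ∃ λ i → f i ≡ y
  hit y with Fin.¬∀⟶∃¬ m _ (λ i → ¬? (f i Fin.≟ y)) (λ avoids → none (y , avoids))
  ... | i , ¬¬eq = i , decidable-stable (f i Fin.≟ y) ¬¬eq

  section-injective : Injective _≡_ _≡_ (proj₁ ∘ hit)
  section-injective {x} {y} eq =
    ≡.trans (≡.sym (proj₂ (hit x))) (≡.trans (≡.cong f eq) (proj₂ (hit y)))

-- A missed value `y` could be punched out of the codomain, leaving an injection into a set with one
-- element fewer.
injective⇒hit : {f : Fin n → Fin n} → Injective _≡_ _≡_ f → ∀ y → ∃ λ i → f i ≡ y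
injective⇒hit {suc n} {f} f-injective y with Fin.any? (λ i → f i Fin.≟ y)
... | yes found = found
... | no  none  = contradiction (Fin.injective⇒≤ avoid-injective) ℕ.1+n≰n
  where
  y≢f : ∀ i → y ≢ f i
  y≢f i eq = none (i , ≡.sym eq)

  avoid-injective : Injective _≡_ _≡_ (λ i → punchOut (y≢f i))
  avoid-injective {i} {j} = f-injective ∘ Fin.punchOut-injective (y≢f i) (y≢f j)

funToFin-cong : {f g : Fin m → Fin n} → f ≗ g → funToFin f ≡ funToFin g
funToFin-cong {zero}  f≗g = ≡.refl
funToFin-cong {suc m} f≗g =
  ≡.cong₂ Fin.combine (f≗g Fin.zero) (funToFin-cong (f≗g ∘ Fin.suc))

finToFun-injective : (i j : Fin (m ^ n)) → finToFun {m} {n} i ≗ finToFun j → i ≡ j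
finToFun-injective {m} {n} i j eq = ≡.trans
  (≡.sym (Fin.funToFin-finToFin {n} {m} i))
  (≡.trans (funToFin-cong eq) (Fin.funToFin-finToFin {n} {m} j))

-- Residues modulo `p` as exponents.

module _ (p : ℕ) .{{_ : NonZero p}} where

  private module ℤₚ = AbelianGroup (ℤmod p)

  %ℕ-≡ₘ : ∀ a → _≡ₘ_ p (+ (a %ℕ p)) a
  %ℕ-≡ₘ a = divides (ℤ.- q) $ ≡.trans
    (≡.cong (λ x → r ℤ.- x) (a≡a%ℕn+[a/ℕn]*n a p)) (lemma r q (+ p))
    where
    r = + (a %ℕ p)
    q = a /ℕ p
    lemma : ∀ r q p → r ℤ.- (r ℤ.+ q ℤ.* p) ≡ ℤ.- q ℤ.* p
    lemma = solve-∀

  private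
    -- The order assumption makes `n ∸ m` the true distance, a multiple of `p`; symmetry removes the
    -- assumption afterwards.
    ≤∧≡ₘ⇒%≡ : m ≤ n → _≡ₘ_ p (+ m) (+ n) → m % p ≡ n % p
    ≤∧≡ₘ⇒%≡ {m} {n} m≤n m≡n with ∣⇒∣ᵤ m≡n
    ... | ℕ.divides q eq = ≡.sym $ ≡.trans (≡.cong (_% p) n≡m+qp) ([m+kn]%n≡m%n m q p)
      where
      ∣m-n∣≡n∸m : ∣ + m ℤ.- + n ∣ ≡ n ∸ m
      ∣m-n∣≡n∸m = ≡.trans (≡.cong ∣_∣ (ℤ.[+m]-[+n]≡m⊖n m n)) (ℤ.∣⊖∣-≤ m≤n)

      n≡m+qp : n ≡ m + q * p
      n≡m+qp = ≡.trans (≡.sym (ℕ.m+[n∸m]≡n m≤n))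
        (≡.cong (λ x → m + x) (≡.trans (≡.sym ∣m-n∣≡n∸m) eq))

  ≡ₘ⇒%≡ : _≡ₘ_ p (+ m) (+ n) → m % p ≡ n % p
  ≡ₘ⇒%≡ {m} {n} m≡n with ℕ.≤-total m n
  ... | inj₁ m≤n = ≤∧≡ₘ⇒%≡ m≤n m≡n
  ... | inj₂ n≤m = ≡.sym (≤∧≡ₘ⇒%≡ n≤m (ℤₚ.sym {+ m} {+ n} m≡n))

  <∧≡ₘ⇒≡ : m < p → n < p → _≡ₘ_ p (+ m) (+ n) → m ≡ n
  <∧≡ₘ⇒≡ m<p n<p m≡n =
    ≡.trans (≡.sym (m<n⇒m%n≡m m<p)) (≡.trans (≡ₘ⇒%≡ m≡n) (m<n⇒m%n≡m n<p))

  %ℕ-cong : ∀ i j → _≡ₘ_ p i j → i %ℕ p ≡ j %ℕ p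
  %ℕ-cong i j i≡j = <∧≡ₘ⇒≡ (n%ℕd<d i p) (n%ℕd<d j p)
    (ℤₚ.trans {+ (i %ℕ p)} {i} {+ (j %ℕ p)} (%ℕ-≡ₘ i)
      (ℤₚ.trans {i} {j} {+ (j %ℕ p)} i≡j (ℤₚ.sym {+ (j %ℕ p)} {j} (%ℕ-≡ₘ j))))

  %ℕ-injective : ∀ i j → i %ℕ p ≡ j %ℕ p → _≡ₘ_ p i j
  %ℕ-injective i j eq =
    ℤₚ.trans {i} {+ (i %ℕ p)} {j} (ℤₚ.sym {+ (i %ℕ p)} {i} (%ℕ-≡ₘ i))
      (≡.subst (λ r → _≡ₘ_ p (+ r) j) (≡.sym eq) (%ℕ-≡ₘ j))

  module _ (M : Monoid c ℓ) where
    open Monoid M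
    open Mult M
    open SetoidReasoning setoid

    ×-≡ₘ : ∀ {x} → p × x ≈ ε → _≡ₘ_ p (+ m) (+ n) → m × x ≈ n × x
    ×-≡ₘ {m} {n} {x} px≈ε m≡n = begin
      m × x        ≈⟨ reduce m ⟩
      (m % p) × x  ≈⟨ ×-congˡ (≡ₘ⇒%≡ m≡n) ⟩
      (n % p) × x  ≈⟨ reduce n ⟨
      n × x        ∎
      where
      ×-ε : ∀ k → k × ε ≈ ε
      ×-ε zero    = refl
      ×-ε (suc k) = trans (identityˡ _) (×-ε k)

      reduce : ∀ k → k × x ≈ (k % p) × x
      reduce k = begin
        k × x                               ≈⟨ ×-congˡ (m≡m%n+[m/n]*n k p) ⟩
        (k % p + k ℕ./ p * p) × x           ≈⟨ ×-homo-+ x (k % p) _ ⟩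
        (k % p) × x ∙ (k ℕ./ p * p) × x     ≈⟨ ∙-congˡ (×-assocˡ x (k ℕ./ p) p) ⟨
        (k % p) × x ∙ (k ℕ./ p) × (p × x)   ≈⟨ ∙-congˡ (×-congʳ (k ℕ./ p) px≈ε) ⟩
        (k % p) × x ∙ (k ℕ./ p) × ε         ≈⟨ ∙-congˡ (×-ε (k ℕ./ p)) ⟩
        (k % p) × x ∙ ε                     ≈⟨ identityʳ _ ⟩
        (k % p) × x                         ∎

    -- Any carry in the addition of residues contributes a `p`-th power of `x`, which is trivial.
    -- This serves twice: exactly, for a central generator, and in the quotient by the centre, for
    -- arbitrary elements.
    ×-%ℕ-homo : ∀ {x} → p × x ≈ ε → ∀ i j →
                ((i ℤ.+ j) %ℕ p) × x ≈ (i %ℕ p) × x ∙ (j %ℕ p) × x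
    ×-%ℕ-homo {x} px≈ε i j = trans
      (×-≡ₘ {m = (i ℤ.+ j) %ℕ p} {n = i %ℕ p + j %ℕ p} px≈ε (ℤₚ.trans
        {+ ((i ℤ.+ j) %ℕ p)} {i ℤ.+ j} {+ (i %ℕ p + j %ℕ p)}
        (%ℕ-≡ₘ (i ℤ.+ j))
        (ℤₚ.sym {+ (i %ℕ p + j %ℕ p)} {i ℤ.+ j}
          (ℤₚ.∙-cong {+ (i %ℕ p)} {i} {+ (j %ℕ p)} {j} (%ℕ-≡ₘ i) (%ℕ-≡ₘ j)))))
      (×-homo-+ x (i %ℕ p) (j %ℕ p))

module _ (M : Monoid c₁ ℓ₁) (N : Monoid c₂ ℓ₂) where
  private
    module M = Monoid M
    module N = Monoid N
  open Mult M using () renaming (_×_ to _×ᴹ_)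
  open Mult N using () renaming (_×_ to _×ᴺ_)

  ×-preserved : (f : M.Carrier → N.Carrier) → f M.ε N.≈ N.ε →
                (∀ x y → f (x M.∙ y) N.≈ f x N.∙ f y) →
                ∀ n x → f (n ×ᴹ x) N.≈ n ×ᴺ f x
  ×-preserved f ε-homo ∙-homo zero    x = ε-homo
  ×-preserved f ε-homo ∙-homo (suc n) x =
    N.trans (∙-homo x (n ×ᴹ x)) (N.∙-congˡ (×-preserved f ε-homo ∙-homo n x))

-- Powers of an element relative to a subgroup.

module _ (G : Group c ℓ) where
  open Group G
  open GroupProperties G
  -- The library's n × x is the power xⁿ, here in multiplicative groups.
  open Mult monoid
  open SetoidReasoning setoid

  trivial-isSubgroup : IsSubgroup G (_≈ ε)
  trivial-isSubgroup = record
    { resp      = λ x≈y x≈ε → trans (sym x≈y) x≈ε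
    ; ε-closed  = refl
    ; ∙-closed  = λ x≈ε y≈ε → trans (∙-cong x≈ε y≈ε) (identityˡ ε)
    ; ⁻¹-closed = λ x≈ε → trans (⁻¹-cong x≈ε) ε⁻¹≈ε
    }

  module _ {H : Pred Carrier a} (H-isSubgroup : IsSubgroup G H) where
    open IsSubgroup H-isSubgroup

    ×-closed : ∀ n {x} → x ∈ H → n × x ∈ H
    ×-closed zero    x∈H = ε-closed
    ×-closed (suc n) x∈H = ∙-closed x∈H (×-closed n x∈H)

    private
      consecutive : ∀ n {x} → n × x ∈ H → suc n × x ∈ H → x ∈ H
      consecutive n {x} nx∈H x+nx∈H =
        resp (//-rightDividesʳ (n × x) x) (∙-closed x+nx∈H (⁻¹-closed nx∈H))

      multiple : ∀ i {x} → n × x ∈ H → (i * n) × x ∈ H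
      multiple {n} i {x} nx∈H = resp (×-assocˡ x i n) (×-closed i nx∈H)

    -- By Bézout over the naturals, some multiple of `m` and some multiple of `n` differ by one.
    -- Both powers of `x` lie in `H`, hence so does their quotient `x`.
    coprime-powers-closed : Coprime m n → ∀ {x} → m × x ∈ H → n × x ∈ H → x ∈ H
    coprime-powers-closed {m} {n} coprime {x} mx∈H nx∈H with coprime-Bézout coprime
    ... | Bézout.+- i j eq = consecutive (j * n) (multiple j nx∈H)
      (≡.subst (λ k → k × x ∈ H) (≡.sym eq) (multiple i mx∈H))
    ... | Bézout.-+ i j eq = consecutive (i * m) (multiple i mx∈H)
      (≡.subst (λ k → k × x ∈ H) (≡.sym eq) (multiple j nx∈H))

    module _ (p-prime : Prime p) {x} (px∈H : p × x ∈ H) (x∉H : x ∉ H) where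

      private
        ordered : ∀ {i j u v} → j < p → i ≤ j → u ∈ H → v ∈ H →
                  i × x ∙ u ≈ j × x ∙ v → i ≡ j
        ordered {i} {j} {u} {v} j<p i≤j u∈H v∈H eq with j ∸ i in j∸i≡d
        ... | zero  = ℕ.≤-antisym i≤j (ℕ.m∸n≡0⇒m≤n j∸i≡d)
        ... | suc d = contradiction
          (coprime-powers-closed (prime⇒coprime p-prime d<p) px∈H
            (resp (sym dx≈uv⁻¹) (∙-closed u∈H (⁻¹-closed v∈H))))
          x∉H
          where
          d<p : suc d < p
          d<p = ℕ.≤-<-trans (≡.subst (_≤ j) j∸i≡d (ℕ.m∸n≤m j i)) j<p

          j≡i+d : j ≡ i + suc d
          j≡i+d = ≡.trans (≡.sym (ℕ.m+[n∸m]≡n i≤j)) (≡.cong (i ℕ.+_) j∸i≡d)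

          u≈dx∙v : u ≈ suc d × x ∙ v
          u≈dx∙v = ∙-cancelˡ (i × x) _ _ $ begin
            i × x ∙ u                ≈⟨ eq ⟩
            j × x ∙ v                ≈⟨ ∙-congʳ (×-congˡ j≡i+d) ⟩
            (i + suc d) × x ∙ v      ≈⟨ ∙-congʳ (×-homo-+ x i (suc d)) ⟩
            i × x ∙ suc d × x ∙ v    ≈⟨ assoc _ _ _ ⟩
            i × x ∙ (suc d × x ∙ v)  ∎

          dx≈uv⁻¹ : suc d × x ≈ u ∙ v ⁻¹
          dx≈uv⁻¹ = x≈z//y (suc d × x) v u (sym u≈dx∙v)

      -- If `i < j`, cancelling `i × x` puts the power of `x` with exponent `j ∸ i` in `H`. That
      -- exponent is positive and below `p`, so coprime to `p`, and together with `p × x` it would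
      -- force `x` into `H`.
      cosets-distinct : ∀ {i j u v} → i < p → j < p → u ∈ H → v ∈ H →
                        i × x ∙ u ≈ j × x ∙ v → i ≡ j
      cosets-distinct {i} {j} i<p j<p u∈H v∈H eq with ℕ.≤-total i j
      ... | inj₁ i≤j = ordered j<p i≤j u∈H v∈H eq
      ... | inj₂ j≤i = ≡.sym (ordered i<p j≤i v∈H u∈H (sym eq))

-- Exponent and generators of finite abelian groups.

module _ (A : AbelianGroup c ℓ) where
  open AbelianGroup A
  open GroupProperties group
  open Mult monoid
  open Sum commutativeMonoid using (sum; sum-permute; sum-cong-≋; ∑-distrib-+; sum-replicate)
  open SetoidReasoning setoid

  -- Translation by x permutes the elements, hence preserves their product.
  order×≈ε : HasOrder setoid n → ∀ x → n × x ≈ ε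
  order×≈ε {n} order x = identityˡ-unique (n × x) (sum from) $ sym $ begin
    sum from                        ≈⟨ sum-permute from translation ⟩
    sum (λ i → from (to (x ∙ from i)))  ≈⟨ sum-cong-≋ (λ i → strictlyInverseʳ (x ∙ from i)) ⟩
    sum (λ i → x ∙ from i)          ≈⟨ ∑-distrib-+ {n} (λ _ → x) from ⟩
    sum {n} (λ _ → x) ∙ sum from    ≈⟨ ∙-congʳ (sum-replicate n) ⟩
    n × x ∙ sum from                ∎
    where
    open Inverse order

    cancels : ∀ {y z} → (∀ w → y ∙ (z ∙ w) ≈ w) →
              ∀ i → to (y ∙ from (to (z ∙ from i))) ≡ i
    cancels y∙z∙-cancels i = ≡.trans
      (to-cong (trans (∙-congˡ (strictlyInverseʳ _)) (y∙z∙-cancels (from i))))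
      (strictlyInverseˡ i)

    translation : Permutation′ n
    translation = permutation (λ i → to (x ∙ from i)) (λ i → to (x ⁻¹ ∙ from i))
      (cancels (\\-leftDividesˡ x)) (cancels (\\-leftDividesʳ x))

  -- The powers of `x` with exponents below `p` are pairwise distinct, so they exhaust a group of
  -- `p` elements.
  prime-order⇒cyclic : Prime p → HasOrder setoid p → ∀ {x} → ¬ x ≈ ε →
                       ∀ y → ∃ λ i → y ≈ i × x
  prime-order⇒cyclic {p} p-prime order {x} x≉ε y
    with injective⇒hit power-injective (to y)
    where
    open Inverse order
    power-injective : Injective _≡_ _≡_ (λ i → to (toℕ i × x))
    power-injective {i} {j} eq = Fin.toℕ-injective $
      cosets-distinct group (trivial-isSubgroup group) p-prime (order×≈ε order x) x≉ε
        (Fin.toℕ<n i) (Fin.toℕ<n j) refl refl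
        (∙-congʳ (trans (sym (strictlyInverseʳ _))
          (trans (from-cong eq) (strictlyInverseʳ _))))
  ... | i , eq = toℕ i , trans (sym (strictlyInverseʳ y))
    (trans (from-cong (≡.sym eq)) (strictlyInverseʳ _))
    where open Inverse order

-- The centre and the quotient by it.

module CentralQuotient (G : Group c ℓ) where
  open Group G
  open GroupProperties G
  open SetoidReasoning setoid

  centre-isSubgroup : IsSubgroup G (Centre G)
  centre-isSubgroup = record
    { resp      = λ x≈y x∈Z g → trans (∙-congʳ (sym x≈y)) (trans (x∈Z g) (∙-congˡ x≈y))
    ; ε-closed  = λ g → trans (identityˡ g) (sym (identityʳ g))
    ; ∙-closed  = λ {x} {y} x∈Z y∈Z g → begin
        x ∙ y ∙ g    ≈⟨ assoc x y g ⟩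
        x ∙ (y ∙ g)  ≈⟨ ∙-congˡ (y∈Z g) ⟩
        x ∙ (g ∙ y)  ≈⟨ assoc x g y ⟨
        x ∙ g ∙ y    ≈⟨ ∙-congʳ (x∈Z g) ⟩
        g ∙ x ∙ y    ≈⟨ assoc g x y ⟩
        g ∙ (x ∙ y)  ∎
    ; ⁻¹-closed = λ {x} x∈Z g → ∙-cancelˡ x _ _ $ begin
        x ∙ (x ⁻¹ ∙ g)  ≈⟨ \\-leftDividesˡ x g ⟩
        g               ≈⟨ //-rightDividesʳ x g ⟨
        g ∙ x ∙ x ⁻¹    ≈⟨ ∙-congʳ (x∈Z g) ⟨
        x ∙ g ∙ x ⁻¹    ≈⟨ assoc x g (x ⁻¹) ⟩
        x ∙ (g ∙ x ⁻¹)  ∎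
    }

  private module Z = IsSubgroup centre-isSubgroup

  -- Equality ignores the proofs of centrality, so the underlying setoid is the one counted by
  -- `centreOrder`.
  centreGroup : AbelianGroup (c ⊔ ℓ) ℓ
  centreGroup = record
    { Carrier = Σ Carrier (Centre G)
    ; _≈_     = λ x y → proj₁ x ≈ proj₁ y
    ; _∙_     = λ (x , x∈Z) (y , y∈Z) → x ∙ y , Z.∙-closed x∈Z y∈Z
    ; ε       = ε , Z.ε-closed
    ; _⁻¹     = λ (x , x∈Z) → x ⁻¹ , Z.⁻¹-closed x∈Z
    ; isAbelianGroup = record
      { isGroup = record
        { isMonoid = record
          { isSemigroup = record
            { isMagma = record
              { isEquivalence = record { refl = refl ; sym = sym ; trans = trans }
              ; ∙-cong = ∙-cong
              }
            ; assoc = λ x y z → assoc (proj₁ x) (proj₁ y) (proj₁ z)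
            }
          ; identity = (λ x → identityˡ (proj₁ x)) , (λ x → identityʳ (proj₁ x))
          }
        ; inverse = (λ x → inverseˡ (proj₁ x)) , (λ x → inverseʳ (proj₁ x))
        ; ⁻¹-cong = ⁻¹-cong
        }
      ; comm = λ x y → proj₂ x (proj₁ y)
      }
    }

  infix 4 _~_
  _~_ : Carrier → Carrier → Set (c ⊔ ℓ)
  x ~ y = ∃ λ z → z ∈ Centre G ∧ x ≈ z ∙ y

  ≈⇒~ : ∀ {x y} → x ≈ y → x ~ y
  ≈⇒~ {x} {y} x≈y = ε , Z.ε-closed , trans x≈y (sym (identityˡ y))

  ~-sym : ∀ {x y} → x ~ y → y ~ x
  ~-sym {x} {y} (z , z∈Z , x≈zy) = z ⁻¹ , Z.⁻¹-closed z∈Z , y≈x\\z z y x (sym x≈zy)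

  ~-trans : ∀ {x y w} → x ~ y → y ~ w → x ~ w
  ~-trans (z , z∈Z , x≈zy) (z′ , z′∈Z , y≈z′w) =
    z ∙ z′ , Z.∙-closed z∈Z z′∈Z , trans x≈zy (trans (∙-congˡ y≈z′w) (sym (assoc z z′ _)))

  ~-∙-cong : ∀ {x y u v} → x ~ y → u ~ v → x ∙ u ~ y ∙ v
  ~-∙-cong {x} {y} {u} {v} (z , z∈Z , x≈zy) (z′ , z′∈Z , u≈z′v) =
    z ∙ z′ , Z.∙-closed z∈Z z′∈Z , (begin
      x ∙ u                ≈⟨ ∙-cong x≈zy u≈z′v ⟩
      (z ∙ y) ∙ (z′ ∙ v)   ≈⟨ solve monoid ⟩
      z ∙ (y ∙ z′) ∙ v     ≈⟨ ∙-congʳ (∙-congˡ (z′∈Z y)) ⟨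
      z ∙ (z′ ∙ y) ∙ v     ≈⟨ solve monoid ⟩
      z ∙ z′ ∙ (y ∙ v)     ∎)

  ~-⁻¹-cong : ∀ {x y} → x ~ y → x ⁻¹ ~ y ⁻¹
  ~-⁻¹-cong {x} {y} (z , z∈Z , x≈zy) = z ⁻¹ , Z.⁻¹-closed z∈Z , (begin
    x ⁻¹         ≈⟨ ⁻¹-cong (trans x≈zy (z∈Z y)) ⟩
    (y ∙ z) ⁻¹   ≈⟨ ⁻¹-anti-homo-∙ y z ⟩
    z ⁻¹ ∙ y ⁻¹  ∎)

  -- The quotient keeps the carrier and operations of `G` and only coarsens equality, so no coset
  -- representatives have to be chosen.
  quotientGroup : (∀ x y → x ∙ y ~ y ∙ x) → AbelianGroup c (c ⊔ ℓ)
  quotientGroup ~-comm = record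
    { Carrier = Carrier
    ; _≈_     = _~_
    ; _∙_     = _∙_
    ; ε       = ε
    ; _⁻¹     = _⁻¹
    ; isAbelianGroup = record
      { isGroup = record
        { isMonoid = record
          { isSemigroup = record
            { isMagma = record
              { isEquivalence = record { refl = ≈⇒~ refl ; sym = ~-sym ; trans = ~-trans }
              ; ∙-cong = ~-∙-cong
              }
            ; assoc = λ x y z → ≈⇒~ (assoc x y z)
            }
          ; identity = (λ x → ≈⇒~ (identityˡ x)) , (λ x → ≈⇒~ (identityʳ x))
          }
        ; inverse = (λ x → ≈⇒~ (inverseˡ x)) , (λ x → ≈⇒~ (inverseʳ x))
        ; ⁻¹-cong = ~-⁻¹-cong
        }
      ; comm = ~-comm
      }
    }

-- Commutators in an extraspecial group.

module Extraspecial {p N : ℕ} (p-prime : Prime p) (G : Group c ℓ)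
                    (extraspecial : IsExtraspecial G p)
                    (order : HasOrder (Group.setoid G) N) where
  open Group G
  open GroupProperties G
  open Mult monoid
  open CentralQuotient G
  open SetoidReasoning setoid
  open IsExtraspecial extraspecial using (centreOrder; centre≐commutator)
  open Inverse order using (to; from; to-cong; from-cong; strictlyInverseˡ; strictlyInverseʳ)

  private
    Z = Centre G
    module Z = IsSubgroup centre-isSubgroup
    module Zᶠ = Inverse centreOrder
    module ZG = AbelianGroup centreGroup
    instance
      p≢0 : NonZero p
      p≢0 = prime⇒nonZero p-prime

    ×ᶻ⇒× : ∀ n {z} (z∈Z : z ∈ Z) → proj₁ (Mult._×_ ZG.monoid n (z , z∈Z)) ≈ n × z
    ×ᶻ⇒× n {z} z∈Z = ×-preserved ZG.monoid monoid proj₁ refl (λ _ _ → refl) n (z , z∈Z)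

  centre-exponent : ∀ {z} → z ∈ Z → p × z ≈ ε
  centre-exponent {z} z∈Z =
    trans (sym (×ᶻ⇒× p z∈Z)) (order×≈ε centreGroup centreOrder (z , z∈Z))

  centre-cyclic : ∀ {z} → z ∈ Z → ¬ z ≈ ε → ∀ {y} → y ∈ Z → ∃ λ i → y ≈ i × z
  centre-cyclic {z} z∈Z z≉ε {y} y∈Z
    with prime-order⇒cyclic centreGroup p-prime centreOrder {z , z∈Z} z≉ε (y , y∈Z)
  ... | i , y≈iz = i , trans y≈iz (×ᶻ⇒× i z∈Z)

  nontrivial-central : ∃ λ ζ → ζ ∈ Z ∧ ¬ ζ ≈ ε
  -- Since `1 < p`, some index in `Fin p` differs from that of the identity.
  nontrivial-central with ∃-unhit {1} (ℕ.nonTrivial⇒n>1 p) (λ _ → Zᶠ.to ZG.ε)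
    where instance _ = prime⇒nonTrivial p-prime
  ... | i , i≢ε = proj₁ (Zᶠ.from i) , proj₂ (Zᶠ.from i) , λ ζ≈ε → i≢ε Fin.zero
    (≡.trans (≡.sym (Zᶠ.to-cong ζ≈ε)) (Zᶠ.strictlyInverseˡ i))

  _≟_ : Decidable _≈_
  _≟_ = via-injection (Inverse⇒Injection order) Fin._≟_

  -- Commuting with the finitely many `from i` suffices. The final case distinction on central
  -- differences rests on this decision.
  Z? : Unary.Decidable Z
  Z? x = map′
    (λ commutes g → trans (∙-congˡ (g≈ g)) (trans (commutes (to g)) (∙-congʳ (sym (g≈ g)))))
    (λ x∈Z i → x∈Z (from i))
    (Fin.all? (λ i → (x ∙ from i) ≟ (from i ∙ x)))
    where
    g≈ : ∀ g → g ≈ from (to g)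
    g≈ g = sym (strictlyInverseʳ g)

  -- This convention is chosen so that conjugating `x` by `g` multiplies `x` on the left by
  -- `[ g , x ]`.
  [_,_] : Carrier → Carrier → Carrier
  [ g , x ] = g ∙ x ∙ g ⁻¹ ∙ x ⁻¹

  commutator∈Z : ∀ g x → [ g , x ] ∈ Z
  -- In the convention of `IsCommutator` this is the commutator of `g ⁻¹` and `x ⁻¹`.
  commutator∈Z g x = proj₂ centre≐commutator $ gen $ g ⁻¹ , x ⁻¹ ,
    ∙-congʳ (∙-congʳ (∙-cong (sym (⁻¹-involutive g)) (sym (⁻¹-involutive x))))

  commute : ∀ g x → g ∙ x ≈ [ g , x ] ∙ (x ∙ g)
  commute g x = sym $ begin
    g ∙ x ∙ g ⁻¹ ∙ x ⁻¹ ∙ (x ∙ g)    ≈⟨ assoc _ _ _ ⟩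
    g ∙ x ∙ g ⁻¹ ∙ (x ⁻¹ ∙ (x ∙ g))  ≈⟨ ∙-congˡ (\\-leftDividesʳ x g) ⟩
    g ∙ x ∙ g ⁻¹ ∙ g                 ≈⟨ //-rightDividesˡ g (g ∙ x) ⟩
    g ∙ x                            ∎

  -- Each of the `n` factors `g` that moves past `x` leaves one copy of `[ g , x ]`; being central,
  -- the copies can be collected in front.
  commute-× : ∀ n g x → n × g ∙ x ≈ n × [ g , x ] ∙ (x ∙ n × g)
  commute-× zero    g x = solve monoid
  commute-× (suc n) g x = begin
    g ∙ gⁿ ∙ x                        ≈⟨ assoc _ _ _ ⟩
    g ∙ (gⁿ ∙ x)                      ≈⟨ ∙-congˡ (commute-× n g x) ⟩
    g ∙ (cⁿ ∙ (x ∙ gⁿ))               ≈⟨ assoc _ _ _ ⟨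
    g ∙ cⁿ ∙ (x ∙ gⁿ)                 ≈⟨ ∙-congʳ (×-closed G centre-isSubgroup n (commutator∈Z g x) g) ⟨
    cⁿ ∙ g ∙ (x ∙ gⁿ)                 ≈⟨ solve monoid ⟩
    cⁿ ∙ (g ∙ x) ∙ gⁿ                 ≈⟨ ∙-congʳ (∙-congˡ (commute g x)) ⟩
    cⁿ ∙ ([ g , x ] ∙ (x ∙ g)) ∙ gⁿ   ≈⟨ reassoc cⁿ [ g , x ] x g gⁿ ⟩
    cⁿ ∙ [ g , x ] ∙ (x ∙ (g ∙ gⁿ))   ≈⟨ ∙-congʳ (commutator∈Z g x cⁿ) ⟨
    [ g , x ] ∙ cⁿ ∙ (x ∙ (g ∙ gⁿ))   ∎
    where
    gⁿ cⁿ : Carrier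
    gⁿ = n × g
    cⁿ = n × [ g , x ]

    reassoc : ∀ a b c d e → a ∙ (b ∙ (c ∙ d)) ∙ e ≈ a ∙ b ∙ (c ∙ (d ∙ e))
    reassoc a b c d e = solve monoid

  -- For `n = p` the collected commutators vanish, because the centre has exponent `p`. Hence the
  -- quotient by the centre has exponent `p`.
  p×∈Z : ∀ g → p × g ∈ Z
  p×∈Z g x = begin
    p × g ∙ x                    ≈⟨ commute-× p g x ⟩
    p × [ g , x ] ∙ (x ∙ p × g)  ≈⟨ ∙-congʳ (centre-exponent (commutator∈Z g x)) ⟩
    ε ∙ (x ∙ p × g)              ≈⟨ identityˡ _ ⟩
    x ∙ p × g                    ∎

  -- Finiteness and decidable equality turn the failure of centrality into an explicit witness.
  noncommuting : ∀ {x} → x ∉ Z → ∃ λ g → ¬ [ g , x ] ≈ ε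
  noncommuting {x} x∉Z
    with Fin.¬∀⟶∃¬ N (λ i → [ from i , x ] ≈ ε) (λ i → [ from i , x ] ≟ ε) ¬∀
    where
    ¬∀ : ¬ (∀ i → [ from i , x ] ≈ ε)
    ¬∀ trivial = x∉Z λ g → sym $ begin
      g ∙ x                                     ≈⟨ ∙-congʳ (strictlyInverseʳ g) ⟨
      from (to g) ∙ x                           ≈⟨ commute _ x ⟩
      [ from (to g) , x ] ∙ (x ∙ from (to g))   ≈⟨ ∙-congʳ (trivial (to g)) ⟩
      ε ∙ (x ∙ from (to g))                     ≈⟨ identityˡ _ ⟩
      x ∙ from (to g)                           ≈⟨ ∙-congˡ (strictlyInverseʳ g) ⟩
      x ∙ g                                     ∎
  ... | i , [gᵢ,x]≉ε = from i , [gᵢ,x]≉ε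

  -- Conjugation-closed sets and cosets of the centre.

  module _ (S : ConnectionSet G s) (conjugationClosed : ConjugationClosed G S) where
    open ConnectionSet S

    -- If g does not commute with x, conjugating x repeatedly by g runs through
    -- all of Zx, because [g , x] generates Z.
    central-translate∈S : ∀ {x z} → x ∉ Z → z ∈ Z → x ∈ set → z ∙ x ∈ set
    central-translate∈S {x} {z} x∉Z z∈Z x∈S with noncommuting x∉Z
    ... | g , [g,x]≉ε with centre-cyclic (commutator∈Z g x) [g,x]≉ε z∈Z
    ... | i , z≈ic = resp (∙-congʳ (sym z≈ic)) (translate i)
      where
      translate : ∀ i → i × [ g , x ] ∙ x ∈ set
      translate zero    = resp (sym (identityˡ x)) x∈S
      translate (suc i) = resp conjugate (conjugationClosed g (translate i))
        where
        cⁱ : Carrier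
        cⁱ = i × [ g , x ]

        reassoc : ∀ a b c d e → a ∙ (b ∙ (c ∙ d)) ∙ e ≈ a ∙ b ∙ c ∙ (d ∙ e)
        reassoc a b c d e = solve monoid

        conjugate : g ∙ (cⁱ ∙ x) ∙ g ⁻¹ ≈ [ g , x ] ∙ cⁱ ∙ x
        conjugate = begin
          g ∙ (cⁱ ∙ x) ∙ g ⁻¹                  ≈⟨ ∙-congʳ (assoc g cⁱ x) ⟨
          g ∙ cⁱ ∙ x ∙ g ⁻¹                    ≈⟨ ∙-congʳ (∙-congʳ (×-closed G centre-isSubgroup i (commutator∈Z g x) g)) ⟨
          cⁱ ∙ g ∙ x ∙ g ⁻¹                    ≈⟨ ∙-congʳ (assoc cⁱ g x) ⟩
          cⁱ ∙ (g ∙ x) ∙ g ⁻¹                  ≈⟨ ∙-congʳ (∙-congˡ (commute g x)) ⟩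
          cⁱ ∙ ([ g , x ] ∙ (x ∙ g)) ∙ g ⁻¹    ≈⟨ reassoc cⁱ [ g , x ] x g (g ⁻¹) ⟩
          cⁱ ∙ [ g , x ] ∙ x ∙ (g ∙ g ⁻¹)      ≈⟨ ∙-congˡ (inverseʳ g) ⟩
          cⁱ ∙ [ g , x ] ∙ x ∙ ε               ≈⟨ identityʳ _ ⟩
          cⁱ ∙ [ g , x ] ∙ x                   ≈⟨ ∙-congʳ (commutator∈Z g x cⁱ) ⟨
          [ g , x ] ∙ cⁱ ∙ x                   ∎

  -- Coordinate systems on the group.

  private
    Q : AbelianGroup _ _
    Q = quotientGroup (λ x y → [ x , y ] , commutator∈Z x y , commute x y)
    module Q = AbelianGroup Q
    module Qₚ = GroupProperties Q.group
    module V k = Group (ElementaryAbelian p k)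
    open CommutativeSemigroupProperties Q.commutativeSemigroup using (interchange)

    p×~ε : ∀ g → p × g ~ ε
    p×~ε g = p × g , p×∈Z g , sym (identityʳ _)

    exponent : ℤ → ℕ
    exponent i = i %ℕ p

    exponent-0 : ∀ g → exponent 0ℤ × g ≈ ε
    exponent-0 g = ×-congˡ {g} (m<n⇒m%n≡m (ℕ.>-nonZero⁻¹ p))

    -- Reducing exponents may drop a factor `p × g`. It is central but can be nontrivial, so
    -- additivity holds only modulo the centre.
    exponent-homo : ∀ g i j → exponent (i ℤ.+ j) × g ~ exponent i × g ∙ exponent j × g
    exponent-homo g i j = ≡.subst₂ _~_ (×ᵠ≡× (exponent (i ℤ.+ j)))
      (≡.cong₂ _∙_ (×ᵠ≡× (exponent i)) (×ᵠ≡× (exponent j)))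
      (×-%ℕ-homo p Q.monoid {g} (≡.subst (_~ ε) (≡.sym (×ᵠ≡× p)) (p×~ε g)) i j)
      where
      ×ᵠ≡× : ∀ n → Mult._×_ Q.monoid n g ≡ n × g
      ×ᵠ≡× zero    = ≡.refl
      ×ᵠ≡× (suc n) = ≡.cong (g ∙_) (×ᵠ≡× n)

  -- A possibly partial coordinate system: surjectivity is no field but follows by counting once
  -- `p ^ k` is the group order. While `∙-homo` holds only modulo the centre, `translate` is exact,
  -- and its vector depends on `z` alone.
  record Coordinates (k : ℕ) : Set (c ⊔ ℓ) where
    open Group (ElementaryAbelian p k) using () renaming
      (Carrier to Vec; _≈_ to _≋_; _∙_ to _⊕_; ε to 𝟎; _⁻¹ to ⊖_)
    field
      element   : Vec → Carrier
      cong      : ∀ {v w} → v ≋ w → element v ≈ element w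
      injective : ∀ {v w} → element v ≈ element w → v ≋ w
      ε-homo    : element 𝟎 ≈ ε
      ∙-homo    : ∀ v w → element (v ⊕ w) ~ element v ∙ element w
      translate : ∀ {z} → z ∈ Z → ∃ λ u → ∀ v → element (v ⊕ u) ≈ z ∙ element v

    Image : Pred Carrier ℓ
    Image x = ∃ λ v → element v ≈ x

    ~-image : ∀ {x y} → x ~ y → y ∈ Image → x ∈ Image
    ~-image (z , z∈Z , x≈zy) (v , v≈y) with translate z∈Z
    ... | u , v⊕u≈zv = v ⊕ u , trans (v⊕u≈zv v) (trans (∙-congˡ v≈y) (sym x≈zy))

    element-⁻¹ : ∀ v → element v ⁻¹ ~ element (⊖ v)
    element-⁻¹ v = Q.sym $ Qₚ.inverseˡ-unique (element (⊖ v)) (element v) $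
      Q.trans (Q.sym (∙-homo (⊖ v) v)) (≈⇒~ (trans (cong (V.inverseˡ k v)) ε-homo))

    element-∙⁻¹ : ∀ v w → element v ∙ element w ⁻¹ ~ element (v ⊕ ⊖ w)
    element-∙⁻¹ v w =
      Q.trans (Q.∙-congˡ {element v} (element-⁻¹ w)) (Q.sym (∙-homo v (⊖ w)))

    -- Although `element` is multiplicative only up to central factors, its image absorbs such
    -- factors by `~-image`.
    image-isSubgroup : IsSubgroup G Image
    image-isSubgroup = record
      { resp      = λ x≈y (v , v≈x) → v , trans v≈x x≈y
      ; ε-closed  = 𝟎 , ε-homo
      ; ∙-closed  = λ (v , v≈x) (w , w≈y) →
          ~-image (≈⇒~ (sym (∙-cong v≈x w≈y))) (~-image (Q.sym (∙-homo v w)) (v ⊕ w , refl))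
      ; ⁻¹-closed = λ (v , v≈x) →
          ~-image (≈⇒~ (sym (⁻¹-cong v≈x))) (~-image (element-⁻¹ v) (⊖ v , refl))
      }

    -- Let `u` be the vector translating by this central quotient `z`. Then `w ⊕ u` and `v` have the
    -- same element, so `u` is `v ⊕ ⊖ w` by injectivity; translating `𝟎` shows that the element of
    -- `u` is `z` itself.
    element-∙⁻¹-central : ∀ v w → element v ∙ element w ⁻¹ ∈ Z →
                          element v ∙ element w ⁻¹ ≈ element (v ⊕ ⊖ w)
    element-∙⁻¹-central v w z∈Z with translate z∈Z
    ... | u , u-translates = begin
      element v ∙ element w ⁻¹                ≈⟨ identityʳ _ ⟨
      element v ∙ element w ⁻¹ ∙ ε            ≈⟨ ∙-congˡ ε-homo ⟨
      element v ∙ element w ⁻¹ ∙ element 𝟎    ≈⟨ u-translates 𝟎 ⟨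
      element (𝟎 ⊕ u)                         ≈⟨ cong (V.identityˡ k u) ⟩
      element u                               ≈⟨ cong u≋v-w ⟩
      element (v ⊕ ⊖ w)                       ∎
      where
      w+u≋v : V._≈_ k (w ⊕ u) v
      w+u≋v = injective (trans (u-translates w) (//-rightDividesˡ (element w) (element v)))

      u≋v-w : V._≈_ k u (v ⊕ ⊖ w)
      u≋v-w = GroupProperties.x≈z//y (ElementaryAbelian p k) u w v
        (V.trans k {u ⊕ w} {w ⊕ u} {v} (λ i → AbelianGroup.comm (ℤmod p) (u i) (w i)) w+u≋v)

  -- Greedy construction of coordinates.

  module _ {ζ} (ζ∈Z : ζ ∈ Z) (ζ≉ε : ¬ ζ ≈ ε) where
    -- Here additivity is exact, since `p × ζ ≈ ε`. As `ζ` generates the centre, translation by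
    -- `i × ζ` amounts to adding `i` to the coordinate.
    centralCoordinates : Coordinates 1
    centralCoordinates = record
      { element   = λ v → exponent (v Fin.zero) × ζ
      ; cong      = λ {v} {w} v≋w → ×-congˡ {ζ} (%ℕ-cong p (v Fin.zero) (w Fin.zero) (v≋w Fin.zero))
      ; injective = λ { {v} {w} eq Fin.zero → %ℕ-injective p (v Fin.zero) (w Fin.zero)
                          (distinct (v Fin.zero) (w Fin.zero) eq) }
      ; ε-homo    = exponent-0 ζ
      ; ∙-homo    = λ v w → exponent-homo ζ (v Fin.zero) (w Fin.zero)
      ; translate = λ z∈Z → let i , z≈iζ = centre-cyclic ζ∈Z ζ≉ε z∈Z in
          (λ _ → + i) , λ v → begin
            exponent (v Fin.zero ℤ.+ + i) × ζ
              ≈⟨ ×-%ℕ-homo p monoid pζ≈ε (v Fin.zero) (+ i) ⟩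
            exponent (v Fin.zero) × ζ ∙ exponent (+ i) × ζ
              ≈⟨ ×-closed G centre-isSubgroup (exponent (+ i)) ζ∈Z _ ⟨
            exponent (+ i) × ζ ∙ exponent (v Fin.zero) × ζ
              ≈⟨ ∙-congʳ (×-≡ₘ p monoid {m = exponent (+ i)} {n = i} pζ≈ε (%ℕ-≡ₘ p (+ i))) ⟩
            i × ζ ∙ exponent (v Fin.zero) × ζ
              ≈⟨ ∙-congʳ z≈iζ ⟨
            _ ∙ exponent (v Fin.zero) × ζ                   ∎
      }
      where
      pζ≈ε : p × ζ ≈ ε
      pζ≈ε = centre-exponent ζ∈Z

      distinct : ∀ i j → exponent i × ζ ≈ exponent j × ζ → exponent i ≡ exponent j
      distinct i j eq = cosets-distinct G (trivial-isSubgroup G) p-prime pζ≈ε ζ≉ε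
        (n%ℕd<d i p) (n%ℕd<d j p) refl refl (∙-congʳ eq)

  module _ {k} (C : Coordinates k) {g} (g∉Image : g ∉ Coordinates.Image C) where
    private module C = Coordinates C

    extend : Coordinates (suc k)
    extend = record
      { element   = element
      ; cong      = λ {v} {w} v≋w → ∙-cong
          (×-congˡ {g} (%ℕ-cong p (v Fin.zero) (w Fin.zero) (v≋w Fin.zero)))
          (C.cong {v ∘ Fin.suc} {w ∘ Fin.suc} (v≋w ∘ Fin.suc))
      ; injective = λ {v} {w} → injective {v} {w}
      ; ε-homo    = trans (∙-cong (exponent-0 g) C.ε-homo) (identityˡ ε)
      -- Regrouping exchanges the two middle factors, which is legitimate in the abelian quotient.
      ; ∙-homo    = λ v w → Q.trans
          (Q.∙-cong (exponent-homo g (v Fin.zero) (w Fin.zero)) (C.∙-homo (v ∘ Fin.suc) (w ∘ Fin.suc)))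
          (interchange (exponent (v Fin.zero) × g) (exponent (w Fin.zero) × g)
                       (C.element (v ∘ Fin.suc)) (C.element (w ∘ Fin.suc)))
      ; translate = translate
      }
      where
      element : (Fin (suc k) → ℤ) → Carrier
      element v = exponent (v Fin.zero) × g ∙ C.element (v ∘ Fin.suc)

      p×g∈Image : p × g ∈ C.Image
      p×g∈Image = C.~-image (p×~ε g) (IsSubgroup.ε-closed C.image-isSubgroup)

      injective : ∀ {v w} → element v ≈ element w → V._≈_ (suc k) v w
      injective {v} {w} eq = λ
        { Fin.zero    → %ℕ-injective p (v Fin.zero) (w Fin.zero) heads
        ; (Fin.suc i) → C.injective tails i
        }
        where
        -- The old image is a subgroup containing `p × g` but not `g`, so the left coset of the
        -- element determines the new coordinate.
        heads : exponent (v Fin.zero) ≡ exponent (w Fin.zero)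
        heads = cosets-distinct G C.image-isSubgroup p-prime p×g∈Image g∉Image
          (n%ℕd<d (v Fin.zero) p) (n%ℕd<d (w Fin.zero) p) (_ , refl) (_ , refl) eq

        tails : C.element (v ∘ Fin.suc) ≈ C.element (w ∘ Fin.suc)
        tails = ∙-cancelˡ _ _ _ (trans eq (∙-congʳ (×-congˡ (≡.sym heads))))

      translate : ∀ {z} → z ∈ Z → ∃ λ u → ∀ v → element (λ i → v i ℤ.+ u i) ≈ z ∙ element v
      translate {z} z∈Z with C.translate z∈Z
      -- A central factor moves past the power of `g`, so the new coordinate is shifted by zero.
      ... | u , u-translates = 0ℤ ∷ u , λ v → begin
        exponent (v Fin.zero ℤ.+ 0ℤ) × g ∙ C.element (λ i → v (Fin.suc i) ℤ.+ u i)
          ≈⟨ ∙-cong (×-congˡ (≡.cong exponent (ℤ.+-identityʳ (v Fin.zero)))) (u-translates (v ∘ Fin.suc)) ⟩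
        exponent (v Fin.zero) × g ∙ (z ∙ C.element (v ∘ Fin.suc))
          ≈⟨ assoc _ _ _ ⟨
        exponent (v Fin.zero) × g ∙ z ∙ C.element (v ∘ Fin.suc)
          ≈⟨ ∙-congʳ (z∈Z _) ⟨
        z ∙ exponent (v Fin.zero) × g ∙ C.element (v ∘ Fin.suc)
          ≈⟨ assoc _ _ _ ⟩
        z ∙ element v ∎

  -- Counting the elements reached by coordinates.

  module _ {k} (C : Coordinates k) where
    private module C = Coordinates C

    -- Vectors are integer functions up to congruence; this picks one representative of each class,
    -- so that the classes can be counted.
    residues : Fin (p ^ k) → Fin k → ℤ
    residues i j = + toℕ (finToFun i j)

    residues-surjective : ∀ v → ∃ λ i → V._≈_ k (residues i) v
    residues-surjective v = funToFin reduced , λ j →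
      ≡.subst (λ r → _≡ₘ_ p (+ r) (v j))
        (≡.sym (≡.trans (≡.cong toℕ (Fin.finToFun-funToFin reduced j)) (Fin.toℕ-fromℕ< _)))
        (%ℕ-≡ₘ p (v j))
      where
      reduced : Fin k → Fin p
      reduced j = fromℕ< (n%ℕd<d (v j) p)

    residues-injective : ∀ i j → V._≈_ k (residues i) (residues j) → i ≡ j
    residues-injective i j eq = finToFun-injective i j λ l →
      Fin.toℕ-injective (<∧≡ₘ⇒≡ p (Fin.toℕ<n (finToFun i l)) (Fin.toℕ<n (finToFun j l)) (eq l))

    outside : p ^ k < N → ∃ λ g → g ∉ C.Image
    outside p^k<N with ∃-unhit p^k<N (to ∘ C.element ∘ residues)
    ... | y , avoided = from y , λ (v , v≈g) → let i , i≋v = residues-surjective v in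
      avoided i (≡.trans (to-cong (trans (C.cong i≋v) v≈g)) (strictlyInverseˡ y))

    surjective : N ≡ p ^ k → ∀ x → x ∈ C.Image
    surjective ≡.refl x with injective⇒hit enumeration-injective (to x)
      where
      enumeration-injective : Injective _≡_ _≡_ (to ∘ C.element ∘ residues)
      enumeration-injective {i} {j} eq = residues-injective i j $ C.injective $
        trans (sym (strictlyInverseʳ _)) (trans (from-cong eq) (strictlyInverseʳ _))
    ... | i , eq = residues i ,
      trans (sym (strictlyInverseʳ _)) (trans (from-cong eq) (strictlyInverseʳ x))

  -- The induction starts with one coordinate, which already spans the centre as `translate`
  -- demands. While `p ^ suc k` is below `N`, counting supplies an element outside the image to
  -- extend by.
  coordinates : ∀ k → p ^ suc k ≤ N → Coordinates (suc k)
  coordinates zero    _ with nontrivial-central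
  ... | ζ , ζ∈Z , ζ≉ε = centralCoordinates ζ∈Z ζ≉ε
  coordinates (suc k) p^2+k≤N = extend C (proj₂ (outside C p^1+k<N))
    where
    instance _ = prime⇒nonTrivial p-prime

    p^1+k<N : p ^ suc k < N
    p^1+k<N = ℕ.<-≤-trans (ℕ.^-monoʳ-< p (ℕ.nonTrivial⇒n>1 p) (ℕ.n<1+n (suc k))) p^2+k≤N

    C : Coordinates (suc k)
    C = coordinates k (ℕ.<⇒≤ p^1+k<N)

  -- Transporting the Cayley graph.

  module _ (S : ConnectionSet G s) (conjugationClosed : ConjugationClosed G S)
           {k} (N≡p^k : N ≡ p ^ k) (C : Coordinates k) where
    open Coordinates C
    open Group (ElementaryAbelian p k) using () renaming (_∙_ to _⊕_; ε to 𝟎; _⁻¹ to ⊖_)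
    private module S = ConnectionSet S

    ~-∈S : ∀ {x y} → x ∉ Z → x ~ y → x ∈ S.set → y ∈ S.set
    ~-∈S x∉Z x~y x∈S with Q.sym x~y
    ... | z , z∈Z , y≈zx =
      S.resp (sym y≈zx) (central-translate∈S S conjugationClosed x∉Z z∈Z x∈S)

    -- Within the centre, `S` need not absorb central factors, so the exact identity is used there;
    -- elsewhere congruence modulo the centre is enough.
    difference∈S : ∀ v w → element v ∙ element w ⁻¹ ∈ S.set ⇔ element (v ⊕ ⊖ w) ∈ S.set
    difference∈S v w with Z? (element v ∙ element w ⁻¹)
    ... | yes central = mk⇔ (S.resp eq) (S.resp (sym eq))
      where eq = element-∙⁻¹-central v w central
    ... | no noncentral = mk⇔
      (~-∈S noncentral (element-∙⁻¹ v w))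
      (~-∈S noncentral′ (Q.sym (element-∙⁻¹ v w)))
      where
      -- Centrality is invariant under `~`, so the converse direction also starts from a noncentral
      -- element.
      noncentral′ : element (v ⊕ ⊖ w) ∉ Z
      noncentral′ v-w∈Z with element-∙⁻¹ v w
      ... | z , z∈Z , eq = noncentral (Z.resp (sym eq) (Z.∙-closed z∈Z v-w∈Z))

    connectionSet : ConnectionSet (ElementaryAbelian p k) s
    connectionSet = record
      { set           = λ v → element v ∈ S.set
      ; resp          = S.resp ∘ cong
      ; ε∉            = S.ε∉ ∘ S.resp ε-homo
      -- The element of `⊖ v` need not be the inverse of that of `v`, so the inverse is read as a
      -- difference from `𝟎` and transferred.
      ; inverseClosed = λ {v} v∈S → S.resp (cong (V.identityˡ k (⊖ v)))
          (Equivalence.to (difference∈S 𝟎 v) (S.resp (element-0∙⁻¹ v) (S.inverseClosed v∈S)))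
      }
      where
      element-0∙⁻¹ : ∀ v → element v ⁻¹ ≈ element 𝟎 ∙ element v ⁻¹
      element-0∙⁻¹ v = sym (trans (∙-congʳ ε-homo) (identityˡ _))

    Cay≅Cay : Cay G S ≅ Cay (ElementaryAbelian p k) connectionSet
    Cay≅Cay = record
      { bijection = record
        { to        = vector
        ; from      = element
        ; to-cong   = λ {x} {y} x≈y → injective
            (trans (element-vector x) (trans x≈y (sym (element-vector y))))
        ; from-cong = cong
        ; inverse   = (λ {v} {x} x≈v → injective (trans (element-vector x) x≈v))
                    , (λ {x} {v} v≋x → trans (cong v≋x) (element-vector x))
        }
      ; adjacency = λ g h → mk⇔
          (Equivalence.to (difference∈S (vector h) (vector g)) ∘ S.resp (sym (quotient≈ g h)))
          (S.resp (quotient≈ g h) ∘ Equivalence.from (difference∈S (vector h) (vector g)))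
      }
      where
      vector : Carrier → V.Carrier k
      vector x = proj₁ (surjective C N≡p^k x)

      element-vector : ∀ x → element (vector x) ≈ x
      element-vector x = proj₂ (surjective C N≡p^k x)

      quotient≈ : ∀ g h → element (vector h) ∙ element (vector g) ⁻¹ ≈ h ∙ g ⁻¹
      quotient≈ g h = ∙-cong (element-vector h) (⁻¹-cong (element-vector g))

lemma5p15 : ∀ {c ℓ s} (p n : ℕ) → Prime p →
    (G : Group c ℓ) → IsExtraspecial G p → HasOrder (Group.setoid G) (p ^ (2 * n + 1)) →
    (S : ConnectionSet G s) → ConjugationClosed G S →
    IsCayleyGraphOf (Cay G S) (ElementaryAbelian p (2 * n + 1))
lemma5p15 p n p-prime G extraspecial order S conjugationClosed =
  connectionSet S conjugationClosed ≡.refl C , Cay≅Cay S conjugationClosed ≡.refl C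
  where
  open Extraspecial p-prime G extraspecial order

  1+2n≡2n+1 : suc (2 * n) ≡ 2 * n + 1
  1+2n≡2n+1 = ℕ.+-comm 1 (2 * n)

  -- The construction yields `suc (2 * n)` coordinates, hence the transport along `1+2n≡2n+1`.
  C : Coordinates (2 * n + 1)
  C = ≡.subst Coordinates 1+2n≡2n+1
    (coordinates (2 * n) (ℕ.≤-reflexive (≡.cong (p ^_) 1+2n≡2n+1)))
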